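{- Let $M=(E,r)$ be an arbitrary matroid on a finite ground set $E$ with rank function $r$, let $M^*=(E,r^*)$ be its dual matroid, and let $q\in\mathbb{C}\setminus\{0,1\}$. Then $$\chi_{M^*}(q)\,\zeta_q(-1)^{|E|}=\sum_{A\subseteq E}(-1)^{|E|-|A|}\,\frac{\chi_{M|A}(q)}{q^{r(A)}}\,\zeta_q(1)^{|A|}$$ and $$\frac{\chi_{M^*}(q)}{q^{r^*(E)}}\,\zeta_q(1)^{|E|}=\sum_{A\subseteq E}\zeta_q(-1)^{|E|-|A|}\,\chi_{M/A}(q).$$
   Context: A matroid $M=(E,r)$ is a finite set $E$ with a rank function $r:2^E\to\mathbb{N}_0$ satisfying: $0\le r(A)\le|A|$; $r(A)\le r(B)$ for $A\subseteq B$; $r(A\cup B)+r(A\cap B)\le r(A)+r(B)$. The dual matroid $M^*=(E,r^*)$ has rank function $r^*(A)=r(E-A)+|A|-r(E)$. For $A\subseteq E$, the restriction $M|A$ is the matroid on $A$ whose rank function is $r$ restricted to $2^A$; the contraction $M/A$ is the matroid on $E-A$ with rank function $B\mapsto r(A\cup B)-r(A)$. The characteristic polynomial of $M$ is $$\chi_M(x)=\sum_{A\subseteq E}(-1)^{|A|}x^{r(E)-r(A)}.$$ For $q\notin\{0,1\}$ put $\zeta_q(z)=\frac{1}{1-q^{ -z}}$, so that $\zeta_q(1)=\frac{1}{1-q^{ -1}}=\frac{q}{q-1}$ and $\zeta_q(-1)=\frac{1}{1-q}$. -}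

module Defs where

open import Algebra.Apartness.Bundles using (HeytingField)
open import Algebra.Bundles using (CommutativeRing)
open import Data.Fin.Subset using (Subset; inside; outside; _⊆_; _∪_; _∩_; _─_; ∣_∣)
open import Data.Fin.Subset.Properties
  using ( out⊆; s⊆s; ⊥⊆; ⊆-antisym; p⊆q⇒∣p∣≤∣q∣; p∩q⊆p; p⊆p∪q; q⊆p∪q; x∈p∪q⁻; ∪-distribˡ-∩
        ; p─⊥≡p; p─q⊆p )
open import Data.Integer.Base as ℤ using (ℤ; +_; -[1+_])
open import Data.Nat.Base using (ℕ; zero; suc; _+_; _∸_; _≤_)
open import Data.Nat.Properties
  using ( +-suc; +-assoc; +-cancelʳ-≤; +-mono-≤; +-monoˡ-≤; +-monoʳ-≤; m≤m+n; m∸n+n≡m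
        ; m≤n+o⇒m∸n≤o; ∸-monoˡ-≤; ≤-trans; ≤-reflexive; module ≤-Reasoning )
open import Data.Nat.Solver using (module +-*-Solver)
open import Data.Product.Base using (_,_; proj₁; proj₂)
open import Data.Sum.Base using ([_,_])
open import Data.Vec.Base using ([]; _∷_)
open import Function.Base using (id; _∘_)
open import Relation.Binary.PropositionalEquality
  using (_≡_; refl; sym; trans; cong; cong₂; subst₂)

private
  variable
    n : ℕ

-- The ground set E is an arbitrary subset of an ambient Fin n, so that M|A and
-- M/A live on A and E ─ A without any relabelling. The values of r on sets not
-- contained in E are meaningless, and no axiom mentions them.
record Matroid (n : ℕ) : Set where
  field
    E        : Subset n
    r        : Subset n → ℕ
    r≤∣∣     : ∀ {A} → A ⊆ E → r A ≤ ∣ A ∣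
    r-mono   : ∀ {A B} → A ⊆ B → B ⊆ E → r A ≤ r B
    r-submod : ∀ {A B} → A ⊆ E → B ⊆ E → r (A ∪ B) + r (A ∩ B) ≤ r A + r B

private
  ∪-lub : ∀ {A B C : Subset n} → A ⊆ C → B ⊆ C → A ∪ B ⊆ C
  ∪-lub {A = A} {B} A⊆C B⊆C x∈ = [ A⊆C , B⊆C ] (x∈p∪q⁻ A B x∈)

  ∪-monoʳ : ∀ (A : Subset n) {B C} → B ⊆ C → A ∪ B ⊆ A ∪ C
  ∪-monoʳ A {C = C} B⊆C = ∪-lub (p⊆p∪q C) (q⊆p∪q A C ∘ B⊆C)

  ─-cover : ∀ (E A : Subset n) {B} → E ─ A ⊆ (E ─ B) ∪ (B ─ A)
  ─-cover (inside  ∷ E) (outside ∷ A) {inside  ∷ B} = s⊆s (─-cover E A {B})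
  ─-cover (inside  ∷ E) (outside ∷ A) {outside ∷ B} = s⊆s (─-cover E A {B})
  ─-cover (inside  ∷ E) (inside  ∷ A) {inside  ∷ B} = out⊆ (─-cover E A {B})
  ─-cover (inside  ∷ E) (inside  ∷ A) {outside ∷ B} = out⊆ (─-cover E A {B})
  ─-cover (outside ∷ E) (outside ∷ A) {_ ∷ B} = out⊆ (─-cover E A {B})
  ─-cover (outside ∷ E) (inside  ∷ A) {_ ∷ B} = out⊆ (─-cover E A {B})
  ─-cover [] [] {[]} = id

  ─-∪ : ∀ (E A B : Subset n) → E ─ (A ∪ B) ≡ (E ─ A) ∩ (E ─ B)
  ─-∪ [] [] [] = refl
  ─-∪ (inside  ∷ E) (inside  ∷ A) (b ∷ B)       = cong (outside ∷_) (─-∪ E A B)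
  ─-∪ (outside ∷ E) (inside  ∷ A) (b ∷ B)       = cong (outside ∷_) (─-∪ E A B)
  ─-∪ (inside  ∷ E) (outside ∷ A) (inside  ∷ B) = cong (outside ∷_) (─-∪ E A B)
  ─-∪ (inside  ∷ E) (outside ∷ A) (outside ∷ B) = cong (inside  ∷_) (─-∪ E A B)
  ─-∪ (outside ∷ E) (outside ∷ A) (inside  ∷ B) = cong (outside ∷_) (─-∪ E A B)
  ─-∪ (outside ∷ E) (outside ∷ A) (outside ∷ B) = cong (outside ∷_) (─-∪ E A B)

  ─-∩ : ∀ (E A B : Subset n) → E ─ (A ∩ B) ≡ (E ─ A) ∪ (E ─ B)
  ─-∩ [] [] [] = refl
  ─-∩ (inside  ∷ E) (inside  ∷ A) (inside  ∷ B) = cong (outside ∷_) (─-∩ E A B)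
  ─-∩ (inside  ∷ E) (inside  ∷ A) (outside ∷ B) = cong (inside  ∷_) (─-∩ E A B)
  ─-∩ (outside ∷ E) (inside  ∷ A) (inside  ∷ B) = cong (outside ∷_) (─-∩ E A B)
  ─-∩ (outside ∷ E) (inside  ∷ A) (outside ∷ B) = cong (outside ∷_) (─-∩ E A B)
  ─-∩ (inside  ∷ E) (outside ∷ A) (b ∷ B)       = cong (inside  ∷_) (─-∩ E A B)
  ─-∩ (outside ∷ E) (outside ∷ A) (inside  ∷ B) = cong (outside ∷_) (─-∩ E A B)
  ─-∩ (outside ∷ E) (outside ∷ A) (outside ∷ B) = cong (outside ∷_) (─-∩ E A B)

  ∣∪∣+∣∩∣ : ∀ (A B : Subset n) → ∣ A ∪ B ∣ + ∣ A ∩ B ∣ ≡ ∣ A ∣ + ∣ B ∣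
  ∣∪∣+∣∩∣ [] [] = refl
  ∣∪∣+∣∩∣ (inside  ∷ A) (inside  ∷ B) = cong suc
    (trans (+-suc _ _) (trans (cong suc (∣∪∣+∣∩∣ A B)) (sym (+-suc _ _))))
  ∣∪∣+∣∩∣ (inside  ∷ A) (outside ∷ B) = cong suc (∣∪∣+∣∩∣ A B)
  ∣∪∣+∣∩∣ (outside ∷ A) (inside  ∷ B) = trans (cong suc (∣∪∣+∣∩∣ A B)) (sym (+-suc _ _))
  ∣∪∣+∣∩∣ (outside ∷ A) (outside ∷ B) = ∣∪∣+∣∩∣ A B

  ∣─∣+∣∣ : ∀ (A B : Subset n) → ∣ B ─ A ∣ + ∣ A ∣ ≡ ∣ A ∪ B ∣
  ∣─∣+∣∣ [] [] = refl
  ∣─∣+∣∣ (inside  ∷ A) (_       ∷ B) = trans (+-suc _ _) (cong suc (∣─∣+∣∣ A B))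
  ∣─∣+∣∣ (outside ∷ A) (inside  ∷ B) = cong suc (∣─∣+∣∣ A B)
  ∣─∣+∣∣ (outside ∷ A) (outside ∷ B) = ∣─∣+∣∣ A B

  ∸-submod : ∀ {c u v x y} → c ≤ u → c ≤ v → c ≤ x → c ≤ y →
             u + v ≤ x + y → (u ∸ c) + (v ∸ c) ≤ (x ∸ c) + (y ∸ c)
  ∸-submod {c} {u} {v} {x} {y} c≤u c≤v c≤x c≤y u+v≤x+y =
    +-cancelʳ-≤ (c + c) _ _
      (subst₂ _≤_ (sym (restore c≤u c≤v)) (sym (restore c≤x c≤y)) u+v≤x+y)
    where
    restore : ∀ {s t} → c ≤ s → c ≤ t → (s ∸ c) + (t ∸ c) + (c + c) ≡ s + t
    restore {s} {t} c≤s c≤t = trans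
      (solve 3 (λ a b d → a :+ b :+ (d :+ d) := (a :+ d) :+ (b :+ d)) refl (s ∸ c) (t ∸ c) c)
      (cong₂ _+_ (m∸n+n≡m c≤s) (m∸n+n≡m c≤t))
      where open +-*-Solver

module _ (M : Matroid n) where
  open Matroid M

  private
    r-subadd : ∀ {A B} → A ⊆ E → B ⊆ E → r (A ∪ B) ≤ r A + r B
    r-subadd A⊆E B⊆E = ≤-trans (m≤m+n _ _) (r-submod A⊆E B⊆E)

    -- A ↦ r (E ─ A) + ∣ A ∣ is monotone and never below r E, so the ∸ in the
    -- definition of the dual rank is an honest subtraction.
    r─+∣∣-mono : ∀ {A B} → A ⊆ B → B ⊆ E → r (E ─ A) + ∣ A ∣ ≤ r (E ─ B) + ∣ B ∣
    r─+∣∣-mono {A} {B} A⊆B B⊆E = begin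
      r (E ─ A) + ∣ A ∣               ≤⟨ +-monoˡ-≤ _ (r-mono (─-cover E A {B}) (∪-lub E─B⊆E B─A⊆E)) ⟩
      r ((E ─ B) ∪ (B ─ A)) + ∣ A ∣   ≤⟨ +-monoˡ-≤ _ (r-subadd E─B⊆E B─A⊆E) ⟩
      r (E ─ B) + r (B ─ A) + ∣ A ∣   ≤⟨ +-monoˡ-≤ _ (+-monoʳ-≤ (r (E ─ B)) (r≤∣∣ B─A⊆E)) ⟩
      r (E ─ B) + ∣ B ─ A ∣ + ∣ A ∣   ≡⟨ +-assoc (r (E ─ B)) _ _ ⟩
      r (E ─ B) + (∣ B ─ A ∣ + ∣ A ∣) ≡⟨ cong (λ k → r (E ─ B) + k) (∣─∣+∣∣ A B) ⟩
      r (E ─ B) + ∣ A ∪ B ∣           ≤⟨ +-monoʳ-≤ (r (E ─ B)) (p⊆q⇒∣p∣≤∣q∣ (∪-lub A⊆B id)) ⟩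
      r (E ─ B) + ∣ B ∣               ∎
      where
      open ≤-Reasoning
      E─B⊆E : E ─ B ⊆ E
      E─B⊆E = p─q⊆p E B
      B─A⊆E : B ─ A ⊆ E
      B─A⊆E = B⊆E ∘ p─q⊆p B A

    rE≤r─+∣∣ : ∀ {A} → A ⊆ E → r E ≤ r (E ─ A) + ∣ A ∣
    rE≤r─+∣∣ {A} A⊆E = begin
      r E                     ≡⟨ cong r (p─⊥≡p E) ⟨
      r (E ─ ∅ {n})               ≤⟨ m≤m+n _ _ ⟩
      r (E ─ ∅ {n}) + ∣ ∅ {n} ∣       ≤⟨ r─+∣∣-mono (⊥⊆ {p = A}) A⊆E ⟩
      r (E ─ A) + ∣ A ∣       ∎
      where
      open ≤-Reasoning
      open import Data.Fin.Subset using () renaming (⊥ to ∅)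

  dual : Matroid n
  dual = record
    { E        = E
    ; r        = λ A → r (E ─ A) + ∣ A ∣ ∸ r E
    ; r≤∣∣     = λ {A} _ → m≤n+o⇒m∸n≤o _ (r E) (+-monoˡ-≤ ∣ A ∣ (r-mono (p─q⊆p E A) id))
    ; r-mono   = λ A⊆B B⊆E → ∸-monoˡ-≤ (r E) (r─+∣∣-mono A⊆B B⊆E)
    ; r-submod = λ {A} {B} A⊆E B⊆E → ∸-submod
        (rE≤r─+∣∣ (∪-lub A⊆E B⊆E)) (rE≤r─+∣∣ (A⊆E ∘ p∩q⊆p A B))
        (rE≤r─+∣∣ A⊆E) (rE≤r─+∣∣ B⊆E)
        (submod A B)
    }
    where
    open +-*-Solver
    interchange : ∀ a b c d → (a + b) + (c + d) ≡ (c + a) + (b + d)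
    interchange = solve 4 (λ a b c d → (a :+ b) :+ (c :+ d) := (c :+ a) :+ (b :+ d)) refl
    interchange′ : ∀ a b c d → (a + b) + (c + d) ≡ (a + c) + (b + d)
    interchange′ = solve 4 (λ a b c d → (a :+ b) :+ (c :+ d) := (a :+ c) :+ (b :+ d)) refl

    submod : ∀ A B → (r (E ─ (A ∪ B)) + ∣ A ∪ B ∣) + (r (E ─ (A ∩ B)) + ∣ A ∩ B ∣)
                     ≤ (r (E ─ A) + ∣ A ∣) + (r (E ─ B) + ∣ B ∣)
    submod A B rewrite ─-∪ E A B | ─-∩ E A B = begin
      (r ((E ─ A) ∩ (E ─ B)) + ∣ A ∪ B ∣) + (r ((E ─ A) ∪ (E ─ B)) + ∣ A ∩ B ∣)
        ≡⟨ interchange (r ((E ─ A) ∩ (E ─ B))) _ (r ((E ─ A) ∪ (E ─ B))) _ ⟩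
      (r ((E ─ A) ∪ (E ─ B)) + r ((E ─ A) ∩ (E ─ B))) + (∣ A ∪ B ∣ + ∣ A ∩ B ∣)
        ≤⟨ +-mono-≤ (r-submod (p─q⊆p E A) (p─q⊆p E B)) (≤-reflexive (∣∪∣+∣∩∣ A B)) ⟩
      (r (E ─ A) + r (E ─ B)) + (∣ A ∣ + ∣ B ∣)
        ≡⟨ interchange′ (r (E ─ A)) (r (E ─ B)) _ _ ⟩
      (r (E ─ A) + ∣ A ∣) + (r (E ─ B) + ∣ B ∣) ∎
      where open ≤-Reasoning

  restriction : (A : Subset n) → A ⊆ E → Matroid n
  restriction A A⊆E = record
    { E        = A
    ; r        = r
    ; r≤∣∣     = λ B⊆A → r≤∣∣ (A⊆E ∘ B⊆A)
    ; r-mono   = λ B⊆C C⊆A → r-mono B⊆C (A⊆E ∘ C⊆A)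
    ; r-submod = λ B⊆A C⊆A → r-submod (A⊆E ∘ B⊆A) (A⊆E ∘ C⊆A)
    }

  contraction : (A : Subset n) → A ⊆ E → Matroid n
  contraction A A⊆E = record
    { E        = E ─ A
    ; r        = λ B → r (A ∪ B) ∸ r A
    ; r≤∣∣     = λ B⊆ → m≤n+o⇒m∸n≤o _ (r A)
        (≤-trans (r-subadd A⊆E (⊆E B⊆)) (+-monoʳ-≤ (r A) (r≤∣∣ (⊆E B⊆))))
    ; r-mono   = λ B⊆C C⊆ → ∸-monoˡ-≤ (r A) (r-mono (∪-monoʳ A B⊆C) (A∪⊆E C⊆))
    ; r-submod = λ {B} {C} B⊆ C⊆ → ∸-submod
        (rA≤ (∪-lub B⊆ C⊆)) (rA≤ (B⊆ ∘ p∩q⊆p B C)) (rA≤ B⊆) (rA≤ C⊆)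
        (subst₂ (λ X Y → r X + r Y ≤ r (A ∪ B) + r (A ∪ C))
          (sym (∪-distribˡ-∪ B C)) (sym (∪-distribˡ-∩ A B C))
          (r-submod (A∪⊆E B⊆) (A∪⊆E C⊆)))
    }
    where
    ⊆E : ∀ {B} → B ⊆ E ─ A → B ⊆ E
    ⊆E B⊆ = p─q⊆p E A ∘ B⊆

    A∪⊆E : ∀ {B} → B ⊆ E ─ A → A ∪ B ⊆ E
    A∪⊆E B⊆ = ∪-lub A⊆E (⊆E B⊆)

    rA≤ : ∀ {B} → B ⊆ E ─ A → r A ≤ r (A ∪ B)
    rA≤ {B} B⊆ = r-mono (p⊆p∪q B) (A∪⊆E B⊆)

    ∪-distribˡ-∪ : ∀ B C → A ∪ (B ∪ C) ≡ (A ∪ B) ∪ (A ∪ C)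
    ∪-distribˡ-∪ B C = ⊆-antisym
      (∪-lub (p⊆p∪q (A ∪ C) ∘ p⊆p∪q B)
             (∪-lub (p⊆p∪q (A ∪ C) ∘ q⊆p∪q A B) (q⊆p∪q (A ∪ B) (A ∪ C) ∘ q⊆p∪q A C)))
      (∪-lub (∪-monoʳ A (p⊆p∪q C)) (∪-monoʳ A (q⊆p∪q B C)))

-- Stated over an arbitrary Heyting field; _#_ is apartness, i.e. the
-- constructive form of ≠. For the complex numbers read classically, _#_ is ≠.
module OverField {c ℓ₁ ℓ₂} (K : HeytingField c ℓ₁ ℓ₂) where

  open HeytingField K renaming (_+_ to _+ᴷ_) hiding (refl; sym; trans)
  private
    module K = HeytingField K
    commutativeRing : CommutativeRing c ℓ₁
    commutativeRing = record { isCommutativeRing = isCommutativeRing }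
    ring = CommutativeRing.ring commutativeRing
  open import Algebra.Properties.Semiring.Exp (CommutativeRing.semiring commutativeRing) public
    using (_^_)
  open import Algebra.Apartness.Properties.HeytingCommutativeRing heytingCommutativeRing
    using (x-0≈x; 1#0; x#0y#0→xy#0; #-congʳ; #-congˡ; invertibleˡ⇒#)

  -- ∑_{A ⊆ E} f A: the subsets of s ∷ E are those omitting the first element
  -- and, if s is inside, also those containing it.
  ∑⊆ : (E : Subset n) → ((A : Subset n) → A ⊆ E → Carrier) → Carrier
  ∑⊆ []            f = f [] id
  ∑⊆ (outside ∷ E) f = ∑⊆ E (λ A A⊆E → f (outside ∷ A) (out⊆ A⊆E))
  ∑⊆ (inside  ∷ E) f = ∑⊆ E (λ A A⊆E → f (outside ∷ A) (out⊆ A⊆E))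
                     +ᴷ ∑⊆ E (λ A A⊆E → f (inside  ∷ A) (s⊆s A⊆E))

  -- Here r A ≤ r E, so ∸ is subtraction.
  χ : Matroid n → Carrier → Carrier
  χ M x = ∑⊆ E (λ A _ → (- 1#) ^ ∣ A ∣ * x ^ (r E ∸ r A))
    where open Matroid M

  -- #⇒invertible x#0 inverts x - 0#, which is x; see ⁻¹-inverseʳ.
  _⁻¹[_] : (x : Carrier) → x # 0# → Carrier
  x ⁻¹[ x#0 ] = proj₁ (#⇒invertible x#0)

  ⁻¹-inverseʳ : ∀ {x} (x#0 : x # 0#) → x * x ⁻¹[ x#0 ] ≈ 1#
  ⁻¹-inverseʳ {x} x#0 =
    K.trans (*-congʳ (K.sym (x-0≈x x))) (proj₂ (proj₂ (#⇒invertible x#0)))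

  infixl 7 _/_[_]
  _/_[_] : (x y : Carrier) → y # 0# → Carrier
  x / y [ y#0 ] = x * y ⁻¹[ y#0 ]

  ^-#0 : ∀ {x} → x # 0# → ∀ k → x ^ k # 0#
  ^-#0 x#0 zero    = 1#0
  ^-#0 x#0 (suc k) = x#0y#0→xy#0 x#0 (^-#0 x#0 k)

  infixr 8 _^ℤ_[_]
  _^ℤ_[_] : (x : Carrier) → ℤ → x # 0# → Carrier
  x ^ℤ (+ k)    [ x#0 ] = x ^ k
  x ^ℤ -[1+ k ] [ x#0 ] = (x ⁻¹[ x#0 ]) ^ suc k

  -- ζ_q(z) = 1 / (1 - q^(-z)) for integers z that are not poles.
  ζ : (q : Carrier) (q#0 : q # 0#) (z : ℤ) → 1# - q ^ℤ (ℤ.- z) [ q#0 ] # 0# → Carrier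
  ζ q q#0 z regular = 1# / (1# - q ^ℤ (ℤ.- z) [ q#0 ]) [ regular ]

  private
    #⇒-#0 : ∀ {x y} → x # y → x - y # 0#
    #⇒-#0 x#y = invertibleˡ⇒#
      (proj₁ inv , K.trans (*-congˡ (x-0≈x _)) (proj₁ (proj₂ inv)))
      where inv = #⇒invertible x#y

  ζ[-1]-regular : ∀ {q} (q#0 : q # 0#) → q # 1# → 1# - q ^ℤ (ℤ.- -[1+ 0 ]) [ q#0 ] # 0#
  ζ[-1]-regular q#0 q#1 = #⇒-#0 (#-congˡ (K.sym (*-identityʳ _)) (#-sym q#1))

  ζ[1]-regular : ∀ {q} (q#0 : q # 0#) → q # 1# → 1# - q ^ℤ (ℤ.- (+ 1)) [ q#0 ] # 0#
  ζ[1]-regular {q} q#0 q#1 = #-congʳ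
    (K.trans (distribˡ _ _ _) (+-cong q⁻¹q≈1 q⁻¹[-1]≈-[q⁻¹1]))
    (x#0y#0→xy#0 q⁻¹#0 (#⇒-#0 q#1))
    where
    open import Algebra.Properties.Ring ring using (-‿distribʳ-*)
    q⁻¹ = q ⁻¹[ q#0 ]

    q⁻¹q≈1 : q⁻¹ * q ≈ 1#
    q⁻¹q≈1 = K.trans (*-comm _ _) (⁻¹-inverseʳ q#0)

    q⁻¹#0 : q⁻¹ # 0#
    q⁻¹#0 = invertibleˡ⇒# (q , K.trans (*-congˡ (x-0≈x _)) (⁻¹-inverseʳ q#0))

    q⁻¹[-1]≈-[q⁻¹1] : q⁻¹ * - 1# ≈ - (q⁻¹ * 1#)
    q⁻¹[-1]≈-[q⁻¹1] = K.sym (-‿distribʳ-* _ _)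

{-# OPTIONS --safe #-}

-- Write a = ζ_q(1), b = ζ_q(-1) and p = 1/q. Then a + b = 1, q b = - a and p a = - b.
-- Since r*(E) - r*(E ─ A) = |A| - r(A), complementing gives
--   χ_{M*}(q) = ∑_{A ⊆ E} (-1)^{|E ─ A|} q^{|A| - r(A)}.
-- On the right-hand sides, exchange the two sums: collecting the terms with a fixed
-- B ⊆ A (restriction), resp. a fixed C = A ∪ B (contraction), the inner sum factors
-- over the elements of E as (a - 1)^{|E ─ B|} a^{|B|}, resp. b^{|E ─ C|} (1 - b)^{|C|}.
-- The relations between a, b, p and q then match both sides term by term.
module Submission where

open import Defs
open import Algebra.Apartness.Bundles using (HeytingField)
open import Algebra.Bundles using (CommutativeRing)
import Algebra.Properties.CommutativeSemiring.Exp as Exp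
import Algebra.Properties.Ring as RingProperties
import Algebra.Solver.Ring.NaturalCoefficients.Default as SemiringSolver
open import Data.Fin.Subset using (Subset; inside; outside; _⊆_; _∪_; _─_; ∣_∣; ⊥)
open import Data.Fin.Subset.Properties using (drop-∷-⊆; ∣⊥∣≡0; p⊆p∪q; p─q⊆p; x∈p∪q⁻)
open import Data.Integer.Base using (+_; -[1+_])
open import Data.Nat.Base as ℕ using (ℕ; zero; suc; _∸_; _≤_)
import Data.Nat.Properties as ℕ
open import Data.Product.Base using (_×_; _,_)
open import Data.Sum.Base using ([_,_])
open import Data.Vec.Base using ([]; _∷_; here)
open import Function.Base using (id; _∘_)
open import Relation.Binary.PropositionalEquality as ≡ using (_≡_)
import Relation.Binary.Reasoning.Setoid as SetoidReasoning
open import Relation.Nullary.Negation.Core using (contradiction)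

private
  variable
    n : ℕ

-- Complements and cardinalities of subsets; truncated subtraction.

p─p≡⊥ : (p : Subset n) → p ─ p ≡ ⊥
p─p≡⊥ []            = ≡.refl
p─p≡⊥ (outside ∷ p) = ≡.cong (outside ∷_) (p─p≡⊥ p)
p─p≡⊥ (inside  ∷ p) = ≡.cong (outside ∷_) (p─p≡⊥ p)

p⊆q⇒p∪[q─p]≡q : {p q : Subset n} → p ⊆ q → p ∪ (q ─ p) ≡ q
p⊆q⇒p∪[q─p]≡q {p = []}          {[]}          p⊆q = ≡.refl
p⊆q⇒p∪[q─p]≡q {p = outside ∷ p} {y ∷ q}       p⊆q = ≡.cong (y ∷_) (p⊆q⇒p∪[q─p]≡q (drop-∷-⊆ p⊆q))
p⊆q⇒p∪[q─p]≡q {p = inside  ∷ p} {inside  ∷ q} p⊆q = ≡.cong (inside ∷_) (p⊆q⇒p∪[q─p]≡q (drop-∷-⊆ p⊆q))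
p⊆q⇒p∪[q─p]≡q {p = inside  ∷ p} {outside ∷ q} p⊆q = contradiction (p⊆q here) λ ()

p⊆q⇒q─[q─p]≡p : {p q : Subset n} → p ⊆ q → q ─ (q ─ p) ≡ p
p⊆q⇒q─[q─p]≡p {p = []}          {[]}          p⊆q = ≡.refl
p⊆q⇒q─[q─p]≡p {p = outside ∷ p} {outside ∷ q} p⊆q = ≡.cong (outside ∷_) (p⊆q⇒q─[q─p]≡p (drop-∷-⊆ p⊆q))
p⊆q⇒q─[q─p]≡p {p = outside ∷ p} {inside  ∷ q} p⊆q = ≡.cong (outside ∷_) (p⊆q⇒q─[q─p]≡p (drop-∷-⊆ p⊆q))
p⊆q⇒q─[q─p]≡p {p = inside  ∷ p} {inside  ∷ q} p⊆q = ≡.cong (inside ∷_) (p⊆q⇒q─[q─p]≡p (drop-∷-⊆ p⊆q))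
p⊆q⇒q─[q─p]≡p {p = inside  ∷ p} {outside ∷ q} p⊆q = contradiction (p⊆q here) λ ()

p⊆q⇒∣q─p∣+∣p∣≡∣q∣ : {p q : Subset n} → p ⊆ q → ∣ q ─ p ∣ ℕ.+ ∣ p ∣ ≡ ∣ q ∣
p⊆q⇒∣q─p∣+∣p∣≡∣q∣ {p = []}          {[]}          p⊆q = ≡.refl
p⊆q⇒∣q─p∣+∣p∣≡∣q∣ {p = outside ∷ p} {outside ∷ q} p⊆q = p⊆q⇒∣q─p∣+∣p∣≡∣q∣ (drop-∷-⊆ p⊆q)
p⊆q⇒∣q─p∣+∣p∣≡∣q∣ {p = outside ∷ p} {inside  ∷ q} p⊆q = ≡.cong suc (p⊆q⇒∣q─p∣+∣p∣≡∣q∣ (drop-∷-⊆ p⊆q))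
p⊆q⇒∣q─p∣+∣p∣≡∣q∣ {p = inside  ∷ p} {inside  ∷ q} p⊆q =
  ≡.trans (ℕ.+-suc _ _) (≡.cong suc (p⊆q⇒∣q─p∣+∣p∣≡∣q∣ (drop-∷-⊆ p⊆q)))
p⊆q⇒∣q─p∣+∣p∣≡∣q∣ {p = inside  ∷ p} {outside ∷ q} p⊆q = contradiction (p⊆q here) λ ()

p⊆q⇒∣q∣∸∣p∣≡∣q─p∣ : {p q : Subset n} → p ⊆ q → ∣ q ∣ ∸ ∣ p ∣ ≡ ∣ q ─ p ∣
p⊆q⇒∣q∣∸∣p∣≡∣q─p∣ {p = p} {q} p⊆q =
  ≡.trans (≡.cong (_∸ ∣ p ∣) (≡.sym (p⊆q⇒∣q─p∣+∣p∣≡∣q∣ p⊆q))) (ℕ.m+n∸n≡m ∣ q ─ p ∣ ∣ p ∣)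

-- Two truncated subtractions in a row subtract the sum `o + (n ∸ o)`, which is `n` because `o ≤ n`.
-- When `m < o`, both sides are cut off at 0.
o≤n⇒[m∸o]∸[n∸o]≡m∸n : ∀ m {n o} → o ≤ n → (m ∸ o) ∸ (n ∸ o) ≡ m ∸ n
o≤n⇒[m∸o]∸[n∸o]≡m∸n m {n} {o} o≤n =
  ≡.trans (ℕ.∸-+-assoc m o (n ∸ o)) (≡.cong (m ∸_) (ℕ.m+[n∸m]≡n o≤n))

-- Ranks and coranks in the dual and in contractions.

module _ (M : Matroid n) where
  open Matroid M
  open Matroid (dual M) using () renaming (r to r*)

  r[E─E]≡0 : r (E ─ E) ≡ 0
  r[E─E]≡0 = ℕ.n≤0⇒n≡0 (ℕ.≤-trans (r≤∣∣ (p─q⊆p E E))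
    (ℕ.≤-reflexive (≡.trans (≡.cong ∣_∣ (p─p≡⊥ E)) (∣⊥∣≡0 n))))

  r*E≡∣E∣∸rE : r* E ≡ ∣ E ∣ ∸ r E
  r*E≡∣E∣∸rE = ≡.cong (λ k → k ℕ.+ ∣ E ∣ ∸ r E) r[E─E]≡0

  -- The axiom `r≤∣∣` of `M/A`, taken on its whole ground set, gives the bound. It ensures that the
  -- `∸ r E` inside `r* (E ─ A)` does not truncate.
  rE≤rA+∣E─A∣ : ∀ {A} → A ⊆ E → r E ≤ r A ℕ.+ ∣ E ─ A ∣
  rE≤rA+∣E─A∣ {A} A⊆E = begin
    r E                            ≡⟨ ≡.cong r (p⊆q⇒p∪[q─p]≡q A⊆E) ⟨
    r (A ∪ (E ─ A))                ≤⟨ ℕ.m≤n+m∸n _ (r A) ⟩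
    r A ℕ.+ (r (A ∪ (E ─ A)) ∸ r A) ≤⟨ ℕ.+-monoʳ-≤ (r A) (Matroid.r≤∣∣ (contraction M A A⊆E) id) ⟩
    r A ℕ.+ ∣ E ─ A ∣               ∎
    where open ℕ.≤-Reasoning

  -- `r E` cancels between the two dual ranks, then `∣ E ─ A ∣` does; what remains is the nullity of
  -- `A` in `M`.
  dual-corank : ∀ {A} → A ⊆ E → r* E ∸ r* (E ─ A) ≡ ∣ A ∣ ∸ r A
  dual-corank {A} A⊆E = begin
    r* E ∸ r* (E ─ A)
      ≡⟨ ≡.cong₂ _∸_ r*E≡∣E∣∸rE (≡.cong (λ B → r B ℕ.+ ∣ E ─ A ∣ ∸ r E) (p⊆q⇒q─[q─p]≡p A⊆E)) ⟩
    (∣ E ∣ ∸ r E) ∸ (r A ℕ.+ ∣ E ─ A ∣ ∸ r E)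
      ≡⟨ o≤n⇒[m∸o]∸[n∸o]≡m∸n ∣ E ∣ (rE≤rA+∣E─A∣ A⊆E) ⟩
    ∣ E ∣ ∸ (r A ℕ.+ ∣ E ─ A ∣)
      ≡⟨ ≡.cong₂ _∸_ (≡.sym (p⊆q⇒∣q─p∣+∣p∣≡∣q∣ A⊆E)) (ℕ.+-comm (r A) _) ⟩
    (∣ E ─ A ∣ ℕ.+ ∣ A ∣) ∸ (∣ E ─ A ∣ ℕ.+ r A)
      ≡⟨ ℕ.[m+n]∸[m+o]≡n∸o ∣ E ─ A ∣ ∣ A ∣ (r A) ⟩
    ∣ A ∣ ∸ r A ∎
    where open ≡.≡-Reasoning

  -- Both ranks in `M/A` are shifted down by `r A`, and the shift cancels since `r A ≤ r (A ∪ B)`.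
  contraction-corank : ∀ {A B} (A⊆E : A ⊆ E) → B ⊆ E ─ A →
    let open Matroid (contraction M A A⊆E) using () renaming (E to E/A; r to r/A)
    in r/A E/A ∸ r/A B ≡ r E ∸ r (A ∪ B)
  contraction-corank {A} {B} A⊆E B⊆E─A = ≡.trans
    (≡.cong (λ C → (r C ∸ r A) ∸ (r (A ∪ B) ∸ r A)) (p⊆q⇒p∪[q─p]≡q A⊆E))
    (o≤n⇒[m∸o]∸[n∸o]≡m∸n (r E) (r-mono (p⊆p∪q B) A∪B⊆E))
    where
    A∪B⊆E : A ∪ B ⊆ E
    A∪B⊆E x∈ = [ A⊆E , p─q⊆p E A ∘ B⊆E─A ] (x∈p∪q⁻ A B x∈)

module _ {c ℓ₁ ℓ₂} (K : HeytingField c ℓ₁ ℓ₂) where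

  open OverField K
  open HeytingField K using (_#_)

  private
    R : CommutativeRing c ℓ₁
    R = record { isCommutativeRing = HeytingField.isCommutativeRing K }

  open CommutativeRing R hiding (zero)
  open Exp commutativeSemiring using (^-congˡ; ^-congʳ; ^-homo-*; ^-distrib-*)
  open RingProperties ring using (-1*x≈-x; -‿involutive)
  open SemiringSolver commutativeSemiring using (solve; _:=_; _:+_; _:*_; con)
  open SetoidReasoning setoid

  -- Sums over the subsets of a set.

  ∑⊆-cong : (E : Subset n) {f g : (A : Subset n) → A ⊆ E → Carrier} →
            (∀ A (A⊆E : A ⊆ E) → f A A⊆E ≈ g A A⊆E) → ∑⊆ E f ≈ ∑⊆ E g
  ∑⊆-cong []            f≈g = f≈g _ _
  ∑⊆-cong (outside ∷ E) f≈g = ∑⊆-cong E (λ _ _ → f≈g _ _)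
  ∑⊆-cong (inside  ∷ E) f≈g = +-cong (∑⊆-cong E (λ _ _ → f≈g _ _)) (∑⊆-cong E (λ _ _ → f≈g _ _))

  ∑⊆-distrib-+ : (E : Subset n) (f g : (A : Subset n) → A ⊆ E → Carrier) →
                 ∑⊆ E (λ A A⊆E → f A A⊆E + g A A⊆E) ≈ ∑⊆ E f + ∑⊆ E g
  ∑⊆-distrib-+ []            f g = refl
  ∑⊆-distrib-+ (outside ∷ E) f g = ∑⊆-distrib-+ E _ _
  ∑⊆-distrib-+ (inside  ∷ E) f g = trans
    (+-cong (∑⊆-distrib-+ E _ _) (∑⊆-distrib-+ E _ _))
    (solve 4 (λ a b c d → (a :+ b) :+ (c :+ d) := (a :+ c) :+ (b :+ d)) refl _ _ _ _)

  *-distribˡ-∑⊆ : (E : Subset n) (k : Carrier) (f : (A : Subset n) → A ⊆ E → Carrier) →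
                  k * ∑⊆ E f ≈ ∑⊆ E (λ A A⊆E → k * f A A⊆E)
  *-distribˡ-∑⊆ []            k f = refl
  *-distribˡ-∑⊆ (outside ∷ E) k f = *-distribˡ-∑⊆ E k _
  *-distribˡ-∑⊆ (inside  ∷ E) k f = trans (distribˡ _ _ _)
    (+-cong (*-distribˡ-∑⊆ E k _) (*-distribˡ-∑⊆ E k _))

  *-distribʳ-∑⊆ : (E : Subset n) (k : Carrier) (f : (A : Subset n) → A ⊆ E → Carrier) →
                  ∑⊆ E f * k ≈ ∑⊆ E (λ A A⊆E → f A A⊆E * k)
  *-distribʳ-∑⊆ E k f = trans (*-comm _ _)
    (trans (*-distribˡ-∑⊆ E k f) (∑⊆-cong E (λ _ _ → *-comm _ _)))

  -- Complementation swaps the two halves of the sum at every element of `E`, whence `+-comm`. `f`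
  -- sees only the set, so no inclusion proof has to be transported.
  ∑⊆-complement : (E : Subset n) (f : Subset n → Carrier) →
                  ∑⊆ E (λ A _ → f A) ≈ ∑⊆ E (λ A _ → f (E ─ A))
  ∑⊆-complement []            f = refl
  ∑⊆-complement (outside ∷ E) f = ∑⊆-complement E _
  ∑⊆-complement (inside  ∷ E) f = trans (+-comm _ _)
    (+-cong (∑⊆-complement E _) (∑⊆-complement E _))

  -- For B ⊆ A ⊆ E an element of E ─ B either avoids A (weight y) or lies in A (weight x).
  ∑⊆-∑⊆-within : (E : Subset n) (x y : Carrier) (f : Subset n → Carrier) →
    ∑⊆ E (λ A _ → y ^ ∣ E ─ A ∣ * x ^ ∣ A ∣ * ∑⊆ A (λ B _ → f B))
      ≈ ∑⊆ E (λ B _ → (y + x) ^ ∣ E ─ B ∣ * x ^ ∣ B ∣ * f B)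
  ∑⊆-∑⊆-within []            x y f = refl
  ∑⊆-∑⊆-within (outside ∷ E) x y f = ∑⊆-∑⊆-within E x y (f ∘ (outside ∷_))
  ∑⊆-∑⊆-within (inside  ∷ E) x y f = begin
    ∑⊆ E (λ A _ → y * y ^ ∣ E ─ A ∣ * x ^ ∣ A ∣ * ∑⊆ A (λ B _ → f₀ B))
      + ∑⊆ E (λ A _ → y ^ ∣ E ─ A ∣ * (x * x ^ ∣ A ∣) * (∑⊆ A (λ B _ → f₀ B) + ∑⊆ A (λ B _ → f₁ B)))
      ≈⟨ +-cong
           (∑⊆-cong E λ _ _ → solve 4 (λ y u v s → (y :* u) :* v :* s := y :* (u :* v :* s)) refl _ _ _ _)
           (∑⊆-cong E λ _ _ → solve 5 (λ x u v s t → u :* (x :* v) :* (s :+ t) :=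
                                         x :* (u :* v :* s) :+ x :* (u :* v :* t)) refl _ _ _ _ _) ⟩
    ∑⊆ E (λ A _ → y * term f₀ A) + ∑⊆ E (λ A _ → x * term f₀ A + x * term f₁ A)
      ≈⟨ +-congˡ (∑⊆-distrib-+ E _ _) ⟩
    ∑⊆ E (λ A _ → y * term f₀ A) + (∑⊆ E (λ A _ → x * term f₀ A) + ∑⊆ E (λ A _ → x * term f₁ A))
      ≈⟨ +-cong (pull y f₀) (+-cong (pull x f₀) (pull x f₁)) ⟩
    y * target f₀ + (x * target f₀ + x * target f₁)
      -- The first element can miss `B` by lying outside `A` or in `A ─ B`; both cases carry the
      -- same sum over `f₀`, which gives the factor `y + x`.
      ≈⟨ solve 4 (λ x y s t → y :* s :+ (x :* s :+ x :* t) := (y :+ x) :* s :+ x :* t) refl _ _ _ _ ⟩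
    (y + x) * target f₀ + x * target f₁
      ≈⟨ +-cong (*-distribˡ-∑⊆ E _ _) (*-distribˡ-∑⊆ E _ _) ⟩
    ∑⊆ E (λ B _ → (y + x) * ((y + x) ^ ∣ E ─ B ∣ * x ^ ∣ B ∣ * f₀ B))
      + ∑⊆ E (λ B _ → x * ((y + x) ^ ∣ E ─ B ∣ * x ^ ∣ B ∣ * f₁ B))
      ≈⟨ +-cong
           (∑⊆-cong E λ _ _ → solve 4 (λ y u v s → y :* (u :* v :* s) := (y :* u) :* v :* s) refl _ _ _ _)
           (∑⊆-cong E λ _ _ → solve 4 (λ x u v s → x :* (u :* v :* s) := u :* (x :* v) :* s) refl _ _ _ _) ⟩
    ∑⊆ E (λ B _ → (y + x) * (y + x) ^ ∣ E ─ B ∣ * x ^ ∣ B ∣ * f₀ B)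
      + ∑⊆ E (λ B _ → (y + x) ^ ∣ E ─ B ∣ * (x * x ^ ∣ B ∣) * f₁ B) ∎
    where
    f₀ f₁ : Subset _ → Carrier
    f₀ = f ∘ (outside ∷_)
    f₁ = f ∘ (inside ∷_)
    term : (Subset _ → Carrier) → Subset _ → Carrier
    term g A = y ^ ∣ E ─ A ∣ * x ^ ∣ A ∣ * ∑⊆ A (λ B _ → g B)
    target : (Subset _ → Carrier) → Carrier
    target g = ∑⊆ E (λ B _ → (y + x) ^ ∣ E ─ B ∣ * x ^ ∣ B ∣ * g B)
    pull : ∀ k g → ∑⊆ E (λ A _ → k * term g A) ≈ k * target g
    pull k g = trans (sym (*-distribˡ-∑⊆ E k _)) (*-congˡ (∑⊆-∑⊆-within E x y g))

  -- An element of C = A ∪ B (disjoint) lies in A (weight 1) or in B (weight y z).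
  ∑⊆-∑⊆-disjoint : (E : Subset n) (y z : Carrier) (f : Subset n → Carrier) →
    ∑⊆ E (λ A _ → y ^ ∣ E ─ A ∣ * ∑⊆ (E ─ A) (λ B _ → z ^ ∣ B ∣ * f (A ∪ B)))
      ≈ ∑⊆ E (λ C _ → y ^ ∣ E ─ C ∣ * (1# + y * z) ^ ∣ C ∣ * f C)
  ∑⊆-∑⊆-disjoint []            y z f =
    solve 1 (λ s → con 1 :* (con 1 :* s) := con 1 :* con 1 :* s) refl _
  ∑⊆-∑⊆-disjoint (outside ∷ E) y z f = ∑⊆-∑⊆-disjoint E y z (f ∘ (outside ∷_))
  ∑⊆-∑⊆-disjoint (inside  ∷ E) y z f = begin
    ∑⊆ E (λ A _ → y * y ^ ∣ E ─ A ∣ * (inner f₀ A + ∑⊆ (E ─ A) (λ B _ → z * z ^ ∣ B ∣ * f₁ (A ∪ B))))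
      + ∑⊆ E (λ A _ → term f₁ A)
      ≈⟨ +-congʳ (∑⊆-cong E λ A _ → trans
           (*-congˡ (+-congˡ (trans (∑⊆-cong (E ─ A) λ _ _ → *-assoc _ _ _) (sym (*-distribˡ-∑⊆ (E ─ A) z _)))))
           (solve 5 (λ y z u s t → y :* u :* (s :+ z :* t) := y :* (u :* s) :+ y :* z :* (u :* t)) refl _ _ _ _ _)) ⟩
    ∑⊆ E (λ A _ → y * term f₀ A + y * z * term f₁ A) + ∑⊆ E (λ A _ → term f₁ A)
      ≈⟨ +-congʳ (∑⊆-distrib-+ E _ _) ⟩
    ∑⊆ E (λ A _ → y * term f₀ A) + ∑⊆ E (λ A _ → y * z * term f₁ A) + ∑⊆ E (λ A _ → term f₁ A)
      ≈⟨ +-cong (+-cong (pull y f₀) (pull (y * z) f₁)) (∑⊆-∑⊆-disjoint E y z f₁) ⟩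
    y * target f₀ + y * z * target f₁ + target f₁
      -- When the first element lies in `C`, the weight `y * z` from `B` and the weight 1 from `A`
      -- share the sum over `f₁`.
      ≈⟨ solve 4 (λ y w s t → y :* s :+ w :* t :+ t := y :* s :+ (con 1 :+ w) :* t) refl _ _ _ _ ⟩
    y * target f₀ + (1# + y * z) * target f₁
      ≈⟨ +-cong (*-distribˡ-∑⊆ E _ _) (*-distribˡ-∑⊆ E _ _) ⟩
    ∑⊆ E (λ C _ → y * (y ^ ∣ E ─ C ∣ * (1# + y * z) ^ ∣ C ∣ * f₀ C))
      + ∑⊆ E (λ C _ → (1# + y * z) * (y ^ ∣ E ─ C ∣ * (1# + y * z) ^ ∣ C ∣ * f₁ C))
      ≈⟨ +-cong
           (∑⊆-cong E λ _ _ → solve 4 (λ y u v s → y :* (u :* v :* s) := (y :* u) :* v :* s) refl _ _ _ _)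
           (∑⊆-cong E λ _ _ → solve 4 (λ x u v s → x :* (u :* v :* s) := u :* (x :* v) :* s) refl _ _ _ _) ⟩
    ∑⊆ E (λ C _ → y * y ^ ∣ E ─ C ∣ * (1# + y * z) ^ ∣ C ∣ * f₀ C)
      + ∑⊆ E (λ C _ → y ^ ∣ E ─ C ∣ * ((1# + y * z) * (1# + y * z) ^ ∣ C ∣) * f₁ C) ∎
    where
    f₀ f₁ : Subset _ → Carrier
    f₀ = f ∘ (outside ∷_)
    f₁ = f ∘ (inside ∷_)
    inner term : (Subset _ → Carrier) → Subset _ → Carrier
    inner g A = ∑⊆ (E ─ A) (λ B _ → z ^ ∣ B ∣ * g (A ∪ B))
    term g A = y ^ ∣ E ─ A ∣ * inner g A
    target : (Subset _ → Carrier) → Carrier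
    target g = ∑⊆ E (λ C _ → y ^ ∣ E ─ C ∣ * (1# + y * z) ^ ∣ C ∣ * g C)
    pull : ∀ k g → ∑⊆ E (λ A _ → k * term g A) ≈ k * target g
    pull k g = trans (sym (*-distribˡ-∑⊆ E k _)) (*-congˡ (∑⊆-∑⊆-disjoint E y z g))

  -- Powers and inverses in the field.

  1^n≈1 : ∀ k → 1# ^ k ≈ 1#
  1^n≈1 zero    = refl
  1^n≈1 (suc k) = trans (*-identityˡ _) (1^n≈1 k)

  ^-inverse : ∀ {x y} → x * y ≈ 1# → ∀ k → x ^ k * y ^ k ≈ 1#
  ^-inverse xy≈1 k = trans (sym (^-distrib-* _ _ k)) (trans (^-congˡ k xy≈1) (1^n≈1 k))

  -- Turns a difference of exponents into a product, which the semiring solver can regroup; `k ≤ m`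
  -- keeps `∸` from truncating.
  ^-∸ : ∀ {x y} → x * y ≈ 1# → ∀ {m k} → k ≤ m → x ^ (m ∸ k) ≈ x ^ m * y ^ k
  ^-∸ {x} {y} xy≈1 {m} {k} k≤m = begin
    x ^ (m ∸ k)                   ≈⟨ *-identityʳ _ ⟨
    x ^ (m ∸ k) * 1#              ≈⟨ *-congˡ (^-inverse xy≈1 k) ⟨
    x ^ (m ∸ k) * (x ^ k * y ^ k) ≈⟨ *-assoc _ _ _ ⟨
    x ^ (m ∸ k) * x ^ k * y ^ k   ≈⟨ *-congʳ (^-homo-* x (m ∸ k) k) ⟨
    x ^ (m ∸ k ℕ.+ k) * y ^ k     ≈⟨ *-congʳ (^-congʳ x (ℕ.m∸n+n≡m k≤m)) ⟩
    x ^ m * y ^ k                 ∎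

  -- Inverses in a Heyting field come from apartness proofs; this identifies them with explicit
  -- candidates, such as `p ^ k` for the inverse of `q ^ k`.
  inverse-unique : ∀ {x y z} → x * y ≈ 1# → x * z ≈ 1# → y ≈ z
  inverse-unique {x} {y} {z} xy≈1 xz≈1 = begin
    y           ≈⟨ *-identityʳ y ⟨
    y * 1#      ≈⟨ *-congˡ xz≈1 ⟨
    y * (x * z) ≈⟨ solve 3 (λ x y z → y :* (x :* z) := (x :* y) :* z) refl x y z ⟩
    x * y * z   ≈⟨ *-congʳ xy≈1 ⟩
    1# * z      ≈⟨ *-identityˡ z ⟩
    z           ∎

  ^-∣∣-split : ∀ x {A E : Subset n} → A ⊆ E → x ^ ∣ E ∣ ≈ x ^ ∣ E ─ A ∣ * x ^ ∣ A ∣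
  ^-∣∣-split x {A} {E} A⊆E =
    trans (^-congʳ x (≡.sym (p⊆q⇒∣q─p∣+∣p∣≡∣q∣ A⊆E))) (^-homo-* x ∣ E ─ A ∣ ∣ A ∣)

  χ-dual : (M : Matroid n) (q : Carrier) → let open Matroid M in
           χ (dual M) q ≈ ∑⊆ E (λ A _ → (- 1#) ^ ∣ E ─ A ∣ * q ^ (∣ A ∣ ∸ r A))
  χ-dual M q = trans
    (∑⊆-complement E (λ A → (- 1#) ^ ∣ A ∣ * q ^ (r* E ∸ r* A)))
    (∑⊆-cong E λ A A⊆E → *-congˡ (^-congʳ q (dual-corank M A⊆E)))
    where
    open Matroid M
    open Matroid (dual M) using () renaming (r to r*)

  -- Relations between the two zeta values, q and its inverse.

  module _ (q : Carrier) (q#0 : q # 0#) (q#1 : q # 1#) where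

    private
      -- `m` is -1 kept as a plain factor, since the commutative semiring solver knows no negation;
      -- sign cancellations go through `m*m≈1` and `1+m≈0`.
      p a b m : Carrier
      p = q ⁻¹[ q#0 ]
      a = ζ q q#0 (+ 1) (ζ[1]-regular q#0 q#1)
      b = ζ q q#0 -[1+ 0 ] (ζ[-1]-regular q#0 q#1)
      m = - 1#

    qp≈1 : q * p ≈ 1#
    qp≈1 = ⁻¹-inverseʳ q#0

    m*m≈1 : m * m ≈ 1#
    m*m≈1 = trans (-1*x≈-x m) (-‿involutive 1#)

    1+m≈0 : 1# + m ≈ 0#
    1+m≈0 = -‿inverseʳ 1#

    [1-q]b≈1 : (1# + m * q) * b ≈ 1#
    [1-q]b≈1 = begin
      (1# + m * q) * b        ≈⟨ *-cong (+-congˡ (trans (-1*x≈-x q) (-‿cong (sym (*-identityʳ q))))) (*-identityˡ _) ⟩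
      (1# - q * 1#) * _       ≈⟨ ⁻¹-inverseʳ (ζ[-1]-regular q#0 q#1) ⟩
      1#                      ∎

    [1-p]a≈1 : (1# + m * p) * a ≈ 1#
    [1-p]a≈1 = begin
      (1# + m * p) * a        ≈⟨ *-cong (+-congˡ (trans (-1*x≈-x p) (-‿cong (sym (*-identityʳ p))))) (*-identityˡ _) ⟩
      (1# - p * 1#) * _       ≈⟨ ⁻¹-inverseʳ (ζ[1]-regular q#0 q#1) ⟩
      1#                      ∎

    -- q (1 - p) = q - 1, so - q b is an inverse of 1 - p, as a is.
    a≈-qb : a ≈ m * (q * b)
    a≈-qb = inverse-unique [1-p]a≈1 (begin
      (1# + m * p) * (m * (q * b))
        ≈⟨ solve 4 (λ m p q b → (con 1 :+ m :* p) :* (m :* (q :* b)) :=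
                                (m :* q :+ (m :* m) :* (q :* p)) :* b) refl m p q b ⟩
      (m * q + (m * m) * (q * p)) * b
        ≈⟨ *-congʳ (trans (+-congˡ (trans (*-cong m*m≈1 qp≈1) (*-identityˡ 1#))) (+-comm _ _)) ⟩
      (1# + m * q) * b ≈⟨ [1-q]b≈1 ⟩
      1# ∎)

    -- Matches the factors of an element of the summation set in the first identity: `q * b` on the
    -- dual side, `m * a` on the restriction side.
    ma≈qb : m * a ≈ q * b
    ma≈qb = trans (*-congˡ a≈-qb)
      (trans (sym (*-assoc m m _)) (trans (*-congʳ m*m≈1) (*-identityˡ _)))

    -- Multiplying `m * a = q * b` by `p` removes `q`. The left side is the factor of an element
    -- outside the summation set in the second identity.
    mpa≈b : m * (p * a) ≈ b
    mpa≈b = begin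
      m * (p * a)   ≈⟨ solve 3 (λ m p a → m :* (p :* a) := p :* (m :* a)) refl m p a ⟩
      p * (m * a)   ≈⟨ *-congˡ ma≈qb ⟩
      p * (q * b)   ≈⟨ solve 3 (λ p q b → p :* (q :* b) := (q :* p) :* b) refl p q b ⟩
      q * p * b     ≈⟨ *-congʳ qp≈1 ⟩
      1# * b        ≈⟨ *-identityˡ b ⟩
      b             ∎

    -- Substituting `- q b` for `a` makes the sum `(1 - q) b`, and `b` inverts `1 - q`.
    b+a≈1 : b + a ≈ 1#
    b+a≈1 = begin
      b + a             ≈⟨ +-congˡ a≈-qb ⟩
      b + m * (q * b)   ≈⟨ solve 3 (λ m q b → b :+ m :* (q :* b) := (con 1 :+ m :* q) :* b) refl m q b ⟩
      (1# + m * q) * b  ≈⟨ [1-q]b≈1 ⟩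
      1#                ∎

    -- `∑⊆-∑⊆-disjoint` at `y = b`, `z = m` produces the weight `1# + y * z`, evaluated here from
    -- `b + a = 1`.
    1+bm≈a : 1# + b * m ≈ a
    1+bm≈a = begin
      1# + b * m        ≈⟨ +-congʳ (sym b+a≈1) ⟩
      b + a + b * m     ≈⟨ solve 3 (λ b a m → b :+ a :+ b :* m := b :* (con 1 :+ m) :+ a) refl b a m ⟩
      b * (1# + m) + a  ≈⟨ +-congʳ (trans (*-congˡ 1+m≈0) (zeroʳ b)) ⟩
      0# + a            ≈⟨ +-identityˡ a ⟩
      a                 ∎

    -- `∑⊆-∑⊆-within` at `y = m`, `x = a` produces the weight `y + x`; it is `a - 1`, hence `- b`.
    m+a≈mb : m + a ≈ m * b
    m+a≈mb = begin
      m + a             ≈⟨ +-congˡ 1+bm≈a ⟨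
      m + (1# + b * m)  ≈⟨ solve 2 (λ b m → m :+ (con 1 :+ b :* m) := (con 1 :+ m) :+ m :* b) refl b m ⟩
      1# + m + m * b    ≈⟨ +-congʳ 1+m≈0 ⟩
      0# + m * b        ≈⟨ +-identityˡ _ ⟩
      m * b             ∎

    -- Characteristic polynomials of restrictions and contractions, and the two identities.

    [q^k]⁻¹≈p^k : ∀ k → (q ^ k) ⁻¹[ ^-#0 q#0 k ] ≈ p ^ k
    [q^k]⁻¹≈p^k k = inverse-unique (⁻¹-inverseʳ (^-#0 q#0 k)) (^-inverse qp≈1 k)

    pq≈1 : p * q ≈ 1#
    pq≈1 = trans (*-comm p q) qp≈1

    -- Dividing by `q ^ r A` cancels that power in every term, so each term depends on `B` alone.
    -- This lets the sums over `B ⊆ A ⊆ E` be exchanged.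
    χ-restriction : (M : Matroid n) → let open Matroid M in ∀ {A} (A⊆E : A ⊆ E) →
      χ (restriction M A A⊆E) q / q ^ r A [ ^-#0 q#0 (r A) ]
        ≈ ∑⊆ A (λ B _ → m ^ ∣ B ∣ * p ^ r B)
    χ-restriction M {A} A⊆E = trans (*-distribʳ-∑⊆ A _ _) (∑⊆-cong A λ B B⊆A → begin
      m ^ ∣ B ∣ * q ^ (r A ∸ r B) * (q ^ r A) ⁻¹[ ^-#0 q#0 (r A) ]
        ≈⟨ *-congʳ (*-congˡ (^-∸ qp≈1 (r-mono B⊆A A⊆E))) ⟩
      m ^ ∣ B ∣ * (q ^ r A * p ^ r B) * (q ^ r A) ⁻¹[ ^-#0 q#0 (r A) ]
        ≈⟨ solve 4 (λ s t u v → s :* (t :* u) :* v := (t :* v) :* (s :* u)) refl _ _ _ _ ⟩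
      q ^ r A * (q ^ r A) ⁻¹[ ^-#0 q#0 (r A) ] * (m ^ ∣ B ∣ * p ^ r B)
        ≈⟨ *-congʳ (⁻¹-inverseʳ (^-#0 q#0 (r A))) ⟩
      1# * (m ^ ∣ B ∣ * p ^ r B)
        ≈⟨ *-identityˡ _ ⟩
      m ^ ∣ B ∣ * p ^ r B ∎)
      where open Matroid M

    -- Apart from the sign, a term sees `A` and `B` only through `A ∪ B`, as `∑⊆-∑⊆-disjoint`
    -- requires.
    χ-contraction : (M : Matroid n) → let open Matroid M in ∀ {A} (A⊆E : A ⊆ E) →
      χ (contraction M A A⊆E) q ≈ ∑⊆ (E ─ A) (λ B _ → m ^ ∣ B ∣ * q ^ (r E ∸ r (A ∪ B)))
    χ-contraction M {A} A⊆E =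
      ∑⊆-cong (E ─ A) λ B B⊆ → *-congˡ (^-congʳ q (contraction-corank M A⊆E B⊆))
      where open Matroid M

    χ-dual-restriction-sum : (M : Matroid n) → let open Matroid M in
      χ (dual M) q * b ^ ∣ E ∣
        ≈ ∑⊆ E (λ A A⊆E → m ^ (∣ E ∣ ∸ ∣ A ∣)
                          * (χ (restriction M A A⊆E) q / q ^ r A [ ^-#0 q#0 (r A) ]) * a ^ ∣ A ∣)
    χ-dual-restriction-sum M = begin
      χ (dual M) q * b ^ ∣ E ∣
        ≈⟨ *-congʳ (χ-dual M q) ⟩
      ∑⊆ E (λ A _ → m ^ ∣ E ─ A ∣ * q ^ (∣ A ∣ ∸ r A)) * b ^ ∣ E ∣
        ≈⟨ *-distribʳ-∑⊆ E _ _ ⟩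
      ∑⊆ E (λ A _ → m ^ ∣ E ─ A ∣ * q ^ (∣ A ∣ ∸ r A) * b ^ ∣ E ∣)
        ≈⟨ ∑⊆-cong E termwise ⟩
      ∑⊆ E (λ A _ → (m + a) ^ ∣ E ─ A ∣ * a ^ ∣ A ∣ * (m ^ ∣ A ∣ * p ^ r A))
        ≈⟨ ∑⊆-∑⊆-within E a m (λ B → m ^ ∣ B ∣ * p ^ r B) ⟨
      ∑⊆ E (λ A _ → m ^ ∣ E ─ A ∣ * a ^ ∣ A ∣ * ∑⊆ A (λ B _ → m ^ ∣ B ∣ * p ^ r B))
        ≈⟨ ∑⊆-cong E (λ A A⊆E → trans
             (solve 3 (λ s t u → s :* t :* u := s :* u :* t) refl _ _ _)
             (*-congʳ (*-cong (^-congʳ m (≡.sym (p⊆q⇒∣q∣∸∣p∣≡∣q─p∣ A⊆E))) (sym (χ-restriction M A⊆E))))) ⟩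
      ∑⊆ E (λ A A⊆E → m ^ (∣ E ∣ ∸ ∣ A ∣)
                      * (χ (restriction M A A⊆E) q / q ^ r A [ ^-#0 q#0 (r A) ]) * a ^ ∣ A ∣) ∎
      where
      open Matroid M
      termwise : ∀ A → A ⊆ E →
        m ^ ∣ E ─ A ∣ * q ^ (∣ A ∣ ∸ r A) * b ^ ∣ E ∣
          ≈ (m + a) ^ ∣ E ─ A ∣ * a ^ ∣ A ∣ * (m ^ ∣ A ∣ * p ^ r A)
      termwise A A⊆E = let k = ∣ E ─ A ∣; j = ∣ A ∣ in begin
        m ^ k * q ^ (j ∸ r A) * b ^ ∣ E ∣
          ≈⟨ *-cong (*-congˡ (^-∸ qp≈1 (r≤∣∣ A⊆E))) (^-∣∣-split b A⊆E) ⟩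
        m ^ k * (q ^ j * p ^ r A) * (b ^ k * b ^ j)
          -- Separates `m * b` per element outside `A`, `q * b` per element of `A`, and the
          -- remaining `p ^ r A`.
          ≈⟨ solve 5 (λ s t u v w → s :* (t :* u) :* (v :* w) := (s :* v) :* (t :* w) :* u) refl _ _ _ _ _ ⟩
        (m ^ k * b ^ k) * (q ^ j * b ^ j) * p ^ r A
          ≈⟨ *-congʳ (*-cong (^-distrib-* m b k) (^-distrib-* q b j)) ⟨
        (m * b) ^ k * (q * b) ^ j * p ^ r A
          ≈⟨ *-congʳ (*-cong (^-congˡ k m+a≈mb) (^-congˡ j ma≈qb)) ⟨
        (m + a) ^ k * (m * a) ^ j * p ^ r A
          ≈⟨ *-congʳ (*-congˡ (^-distrib-* m a j)) ⟩
        (m + a) ^ k * (m ^ j * a ^ j) * p ^ r A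
          ≈⟨ solve 4 (λ s t u v → s :* (t :* u) :* v := s :* u :* (t :* v)) refl _ _ _ _ ⟩
        (m + a) ^ k * a ^ j * (m ^ j * p ^ r A) ∎

    χ-dual-contraction-sum : (M : Matroid n) →
      let open Matroid M
          open Matroid (dual M) using () renaming (r to r*)
      in
      (χ (dual M) q / q ^ r* E [ ^-#0 q#0 (r* E) ]) * a ^ ∣ E ∣
        ≈ ∑⊆ E (λ A A⊆E → b ^ (∣ E ∣ ∸ ∣ A ∣) * χ (contraction M A A⊆E) q)
    χ-dual-contraction-sum M = begin
      χ (dual M) q * (q ^ r* E) ⁻¹[ ^-#0 q#0 (r* E) ] * a ^ ∣ E ∣
        -- Since `r* E = ∣ E ∣ ∸ r E`, dividing by `q ^ r* E` multiplies by `p ^ ∣ E ∣ * q ^ r E`;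
        -- the factor `q ^ r E` later completes `q ^ (r E ∸ r A)`.
        ≈⟨ *-congʳ (*-cong (χ-dual M q) (trans ([q^k]⁻¹≈p^k (r* E))
             (trans (^-congʳ p (r*E≡∣E∣∸rE M)) (^-∸ pq≈1 (r≤∣∣ id))))) ⟩
      ∑⊆ E (λ A _ → m ^ ∣ E ─ A ∣ * q ^ (∣ A ∣ ∸ r A)) * (p ^ ∣ E ∣ * q ^ r E) * a ^ ∣ E ∣
        ≈⟨ trans (*-assoc _ _ _) (*-distribʳ-∑⊆ E _ _) ⟩
      ∑⊆ E (λ A _ → m ^ ∣ E ─ A ∣ * q ^ (∣ A ∣ ∸ r A) * (p ^ ∣ E ∣ * q ^ r E * a ^ ∣ E ∣))
        ≈⟨ ∑⊆-cong E termwise ⟩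
      ∑⊆ E (λ C _ → b ^ ∣ E ─ C ∣ * (1# + b * m) ^ ∣ C ∣ * q ^ (r E ∸ r C))
        ≈⟨ ∑⊆-∑⊆-disjoint E b m (λ C → q ^ (r E ∸ r C)) ⟨
      ∑⊆ E (λ A _ → b ^ ∣ E ─ A ∣ * ∑⊆ (E ─ A) (λ B _ → m ^ ∣ B ∣ * q ^ (r E ∸ r (A ∪ B))))
        ≈⟨ ∑⊆-cong E (λ A A⊆E → *-cong (^-congʳ b (≡.sym (p⊆q⇒∣q∣∸∣p∣≡∣q─p∣ A⊆E)))
             (sym (χ-contraction M A⊆E))) ⟩
      ∑⊆ E (λ A A⊆E → b ^ (∣ E ∣ ∸ ∣ A ∣) * χ (contraction M A A⊆E) q) ∎
      where
      open Matroid M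
      open Matroid (dual M) using () renaming (r to r*)
      termwise : ∀ A → A ⊆ E →
        m ^ ∣ E ─ A ∣ * q ^ (∣ A ∣ ∸ r A) * (p ^ ∣ E ∣ * q ^ r E * a ^ ∣ E ∣)
          ≈ b ^ ∣ E ─ A ∣ * (1# + b * m) ^ ∣ A ∣ * q ^ (r E ∸ r A)
      termwise A A⊆E = let k = ∣ E ─ A ∣; j = ∣ A ∣ in begin
        m ^ k * q ^ (j ∸ r A) * (p ^ ∣ E ∣ * q ^ r E * a ^ ∣ E ∣)
          ≈⟨ *-cong (*-congˡ (^-∸ qp≈1 (r≤∣∣ A⊆E))) (*-cong (*-congʳ (^-∣∣-split p A⊆E)) (^-∣∣-split a A⊆E)) ⟩
        m ^ k * (q ^ j * p ^ r A) * (p ^ k * p ^ j * q ^ r E * (a ^ k * a ^ j))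
          -- Each element of `A` carries `a` and a cancelling `q * p`; each element outside `A`
          -- carries `m * (p * a)`, which is `b`.
          ≈⟨ solve 8 (λ mk qj pr pk pj qR ak aj →
               mk :* (qj :* pr) :* (pk :* pj :* qR :* (ak :* aj)) :=
               (qj :* pj) :* ((mk :* (pk :* ak)) :* aj :* (qR :* pr))) refl _ _ _ _ _ _ _ _ ⟩
        (q ^ j * p ^ j) * ((m ^ k * (p ^ k * a ^ k)) * a ^ j * (q ^ r E * p ^ r A))
          ≈⟨ trans (*-congʳ (^-inverse qp≈1 j)) (*-identityˡ _) ⟩
        (m ^ k * (p ^ k * a ^ k)) * a ^ j * (q ^ r E * p ^ r A)
          ≈⟨ *-cong (*-congʳ (trans (^-distrib-* m (p * a) k) (*-congˡ (^-distrib-* p a k))))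
               (^-∸ qp≈1 (r-mono A⊆E id)) ⟨
        (m * (p * a)) ^ k * a ^ j * q ^ (r E ∸ r A)
          ≈⟨ *-congʳ (*-cong (^-congˡ k mpa≈b) (^-congˡ j (sym 1+bm≈a))) ⟩
        b ^ k * (1# + b * m) ^ j * q ^ (r E ∸ r A) ∎

theorem1 : ∀ {c ℓ₁ ℓ₂} (K : HeytingField c ℓ₁ ℓ₂) →
    let open HeytingField K
        open OverField K
    in (n : ℕ) (M : Matroid n) (q : Carrier) (q#0 : q # 0#) (q#1 : q # 1#) →
    let open Matroid M
        open Matroid (dual M) using () renaming (r to r*)
        ζ[1]  = ζ q q#0 (+ 1) (ζ[1]-regular q#0 q#1)
        ζ[-1] = ζ q q#0 -[1+ 0 ] (ζ[-1]-regular q#0 q#1)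
    in
    (χ (dual M) q * ζ[-1] ^ ∣ E ∣
      ≈ ∑⊆ E (λ A A⊆E → (- 1#) ^ (∣ E ∣ ∸ ∣ A ∣)
                        * (χ (restriction M A A⊆E) q / q ^ r A [ ^-#0 q#0 (r A) ])
                        * ζ[1] ^ ∣ A ∣))
    ×
    ((χ (dual M) q / q ^ r* E [ ^-#0 q#0 (r* E) ]) * ζ[1] ^ ∣ E ∣
      ≈ ∑⊆ E (λ A A⊆E → ζ[-1] ^ (∣ E ∣ ∸ ∣ A ∣) * χ (contraction M A A⊆E) q))
theorem1 K n M q q#0 q#1 =
  χ-dual-restriction-sum K q q#0 q#1 M , χ-dual-contraction-sum K q q#0 q#1 M
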